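{- Let $\mathbf{P}\colon\mathsf{C}^{\mathrm{op}}\to\mathsf{BA}$ be a Boolean doctrine and $(\mathrm{id}_{\mathsf{C}},\mathfrak{i})\colon\mathbf{P}\to\mathbf{P}^{\forall\exists}$ a quantifier completion of $\mathbf{P}$. If $\mathbf{P}$ is elementary, then $\mathbf{P}^{\forall\exists}$ is elementary, and the Boolean doctrine morphism $(\mathrm{id}_{\mathsf{C}},\mathfrak{i})$ is elementary.
   Context: $\mathsf{BA}$ is the category of Boolean algebras and Boolean homomorphisms. A Boolean doctrine over a category $\mathsf{C}$ with finite products is a functor $\mathbf{P}\colon\mathsf{C}^{\mathrm{op}}\to\mathsf{BA}$. A Boolean doctrine morphism from $\mathbf{P}\colon\mathsf{C}^{\mathrm{op}}\to\mathsf{BA}$ to $\mathbf{R}\colon\mathsf{D}^{\mathrm{op}}\to\mathsf{BA}$ is a pair $(M,\mathfrak{m})$ with $M\colon\mathsf{C}\to\mathsf{D}$ a finite-product-preserving functor and $\mathfrak{m}\colon\mathbf{P}\to\mathbf{R}\circ M^{\mathrm{op}}$ a natural transformation; $(N,\mathfrak{n})\circ(M,\mathfrak{m})$ is $N\circ M$ together with the components $\mathfrak{n}_{M(X)}\circ\mathfrak{m}_X$. A Boolean doctrine $\mathbf{P}$ is a first-order Boolean doctrine if (i) for all $X,Y\in\mathsf{C}$ the map $\mathbf{P}(\mathrm{pr}_1)\colon\mathbf{P}(X)\to\mathbf{P}(X\times Y)$ has a right adjoint $(\forall Y)_X$ (as an order-preserving map); and (ii) for every $f\colon X'\to X$ and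 every $Y$, $\mathbf{P}(f)\circ(\forall Y)_X=(\forall Y)_{X'}\circ\mathbf{P}(f\times\mathrm{id}_Y)$. A first-order Boolean doctrine morphism is a Boolean doctrine morphism $(M,\mathfrak{m})$ between first-order Boolean doctrines with $\mathfrak{m}_X\circ(\forall Y)_X=(\forall M(Y))_{M(X)}\circ\mathfrak{m}_{X\times Y}$ for all $X,Y$. A quantifier completion of a Boolean doctrine $\mathbf{P}$ is a Boolean doctrine morphism $(I,\mathfrak{i})\colon\mathbf{P}\to\mathbf{P}^{\forall\exists}$ with $\mathbf{P}^{\forall\exists}$ a first-order Boolean doctrine, such that for every first-order Boolean doctrine $\mathbf{R}$ (over any base category) and every Boolean doctrine morphism $(M,\mathfrak{m})\colon\mathbf{P}\to\mathbf{R}$ there is a unique first-order Boolean doctrine morphism $(N,\mathfrak{n})\colon\mathbf{P}^{\forall\exists}\to\mathbf{R}$ with $(M,\mathfrak{m})=(N,\mathfrak{n})\circ(I,\mathfrak{i})$. A Boolean doctrine $\mathbf{P}\colon\mathsf{C}^{\mathrm{op}}\to\mathsf{BA}$ is elementary if there is a family $(\delta_X)_{X\in\mathsf{C}}$ with $\delta_X\in\mathbf{P}(X\times X)$ such that for all $X,Y\in\mathsf{C}$: (1) $\top_{\mathbf{P}(X)}\le\mathbf{P}(\Delta_X)(\delta_X)$, where $\Delta_X\colon X\to X\times X$ is the diagonal; (2) for every $\alpha\in\mathbf{P}(X)$, $\mathbf{P}(\mathrm{pr}_1)(\alpha)\land\delta_X\le\mathbf{P}(\mathrm{pr}_2)(\alpha)$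 in $\mathbf{P}(X\times X)$; (3) $\mathbf{P}(\langle\mathrm{pr}_1,\mathrm{pr}_3\rangle)(\delta_X)\land\mathbf{P}(\langle\mathrm{pr}_2,\mathrm{pr}_4\rangle)(\delta_Y)\le\delta_{X\times Y}$ in $\mathbf{P}(X\times Y\times X\times Y)$. Such a family is unique; $\delta_X=\delta_X^{\mathbf{P}}$ is called the fibered equality on $X$. A Boolean doctrine morphism $(M,\mathfrak{m})\colon\mathbf{P}\to\mathbf{R}$ between elementary Boolean doctrines is elementary if $\mathfrak{m}_{X\times X}(\delta^{\mathbf{P}}_X)=\delta^{\mathbf{R}}_{M(X)}$ for all $X$. -}

module Defs where

open import Level using (Level; _⊔_; suc)
open import Data.Product using (_,_; _×_; ∃!)
open import Relation.Binary.Core using (Rel)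
open import Relation.Binary.Structures using (IsEquivalence)
open import Relation.Binary.Definitions using (Adjoint; Monotonic₁)
open import Relation.Binary.PropositionalEquality using (_≡_; subst; subst₂)
open import Algebra.Lattice.Bundles using (BooleanAlgebra)
open import Algebra.Lattice.Morphism.Structures using (IsLatticeHomomorphism)
import Algebra.Lattice.Morphism.Construct.Identity as Identity
import Algebra.Lattice.Morphism.Construct.Composition as Composition
import Algebra.Lattice.Properties.Lattice as LatticeProperties
import Relation.Binary.Bundles as Bundles

private
  variable
    o ℓ e o′ ℓ′ e′ o″ ℓ″ e″ b : Level

------------------------------------------------------------------------
-- Categories, functors, natural transformations

-- Hom-sets are setoids; objects are compared by propositional equality
-- (which matters in _≈ᵈ_ below).
record Category (o ℓ e : Level) : Set (suc (o ⊔ ℓ ⊔ e)) where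
  infix  4 _≈_ _⇒_
  infixr 9 _∘_
  field
    Obj       : Set o
    _⇒_       : Obj → Obj → Set ℓ
    _≈_       : ∀ {A B} → Rel (A ⇒ B) e
    id        : ∀ {A} → A ⇒ A
    _∘_       : ∀ {A B C} → B ⇒ C → A ⇒ B → A ⇒ C
    assoc     : ∀ {A B C D} {f : A ⇒ B} {g : B ⇒ C} {h : C ⇒ D} →
                (h ∘ g) ∘ f ≈ h ∘ (g ∘ f)
    identityˡ : ∀ {A B} {f : A ⇒ B} → id ∘ f ≈ f
    identityʳ : ∀ {A B} {f : A ⇒ B} → f ∘ id ≈ f
    equiv     : ∀ {A B} → IsEquivalence (_≈_ {A} {B})
    ∘-resp-≈  : ∀ {A B C} {f h : B ⇒ C} {g i : A ⇒ B} →
                f ≈ h → g ≈ i → f ∘ g ≈ h ∘ i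

  module ≈ {A B} = IsEquivalence (equiv {A} {B})

  op : Category o ℓ e
  op = record
    { Obj       = Obj
    ; _⇒_       = λ A B → B ⇒ A
    ; _≈_       = _≈_
    ; id        = id
    ; _∘_       = λ f g → g ∘ f
    ; assoc     = ≈.sym assoc
    ; identityˡ = identityʳ
    ; identityʳ = identityˡ
    ; equiv     = equiv
    ; ∘-resp-≈  = λ p q → ∘-resp-≈ q p
    }

record Functor (C : Category o ℓ e) (D : Category o′ ℓ′ e′) :
               Set (o ⊔ ℓ ⊔ e ⊔ o′ ⊔ ℓ′ ⊔ e′) where
  private
    module C = Category C
    module D = Category D
  field
    F₀           : C.Obj → D.Obj
    F₁           : ∀ {A B} → A C.⇒ B → F₀ A D.⇒ F₀ B
    identity     : ∀ {A} → F₁ (C.id {A}) D.≈ D.id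
    homomorphism : ∀ {X Y Z} {f : X C.⇒ Y} {g : Y C.⇒ Z} →
                   F₁ (g C.∘ f) D.≈ F₁ g D.∘ F₁ f
    F-resp-≈     : ∀ {A B} {f g : A C.⇒ B} → f C.≈ g → F₁ f D.≈ F₁ g

  opF : Functor C.op D.op
  opF = record
    { F₀           = F₀
    ; F₁           = F₁
    ; identity     = identity
    ; homomorphism = homomorphism
    ; F-resp-≈     = F-resp-≈
    }

idF : {C : Category o ℓ e} → Functor C C
idF {C = C} = record
  { F₀           = λ A → A
  ; F₁           = λ f → f
  ; identity     = ≈.refl
  ; homomorphism = ≈.refl
  ; F-resp-≈     = λ p → p
  } where open Category C

infixr 9 _∘F_

_∘F_ : {C : Category o ℓ e} {D : Category o′ ℓ′ e′} {E : Category o″ ℓ″ e″} →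
       Functor D E → Functor C D → Functor C E
_∘F_ {E = E} G F = record
  { F₀           = λ A → G.F₀ (F.F₀ A)
  ; F₁           = λ f → G.F₁ (F.F₁ f)
  ; identity     = ≈.trans (G.F-resp-≈ F.identity) G.identity
  ; homomorphism = ≈.trans (G.F-resp-≈ F.homomorphism) G.homomorphism
  ; F-resp-≈     = λ p → G.F-resp-≈ (F.F-resp-≈ p)
  } where
    module F = Functor F
    module G = Functor G
    open Category E

record NaturalTransformation {C : Category o ℓ e} {D : Category o′ ℓ′ e′}
                             (F G : Functor C D) :
                             Set (o ⊔ ℓ ⊔ ℓ′ ⊔ e′) where
  private
    module C = Category C
    module D = Category D
    module F = Functor F
    module G = Functor G
  field
    η       : ∀ X → F.F₀ X D.⇒ G.F₀ X
    commute : ∀ {X Y} (f : X C.⇒ Y) → η Y D.∘ F.F₁ f D.≈ G.F₁ f D.∘ η X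

------------------------------------------------------------------------
-- Finite products

module _ (C : Category o ℓ e) where
  open Category C

  record IsTerminal (T : Obj) : Set (o ⊔ ℓ ⊔ e) where
    field
      !        : ∀ {A} → A ⇒ T
      !-unique : ∀ {A} (f : A ⇒ T) → ! ≈ f

  record IsProduct {A B P : Obj} (π₁ : P ⇒ A) (π₂ : P ⇒ B) :
                   Set (o ⊔ ℓ ⊔ e) where
    field
      ⟨_,_⟩    : ∀ {Z} → Z ⇒ A → Z ⇒ B → Z ⇒ P
      project₁ : ∀ {Z} {f : Z ⇒ A} {g : Z ⇒ B} → π₁ ∘ ⟨ f , g ⟩ ≈ f
      project₂ : ∀ {Z} {f : Z ⇒ A} {g : Z ⇒ B} → π₂ ∘ ⟨ f , g ⟩ ≈ g
      unique   : ∀ {Z} {h : Z ⇒ P} {f : Z ⇒ A} {g : Z ⇒ B} →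
                 π₁ ∘ h ≈ f → π₂ ∘ h ≈ g → ⟨ f , g ⟩ ≈ h

record FPCategory (o ℓ e : Level) : Set (suc (o ⊔ ℓ ⊔ e)) where
  field
    category : Category o ℓ e
  open Category category public
  infixr 7 _⊗_
  infixr 8 _⁂_
  field
    𝟙          : Obj
    𝟙-terminal : IsTerminal category 𝟙
    _⊗_        : Obj → Obj → Obj
    π₁         : ∀ {A B} → A ⊗ B ⇒ A
    π₂         : ∀ {A B} → A ⊗ B ⇒ B
    ⊗-product  : ∀ {A B} → IsProduct category (π₁ {A} {B}) π₂
  open module ⊗-IsProduct {A} {B} =
    IsProduct (⊗-product {A} {B}) public

  Δ : ∀ {A} → A ⇒ A ⊗ A
  Δ = ⟨ id , id ⟩

  _⁂_ : ∀ {A B A′ B′} → A ⇒ A′ → B ⇒ B′ → A ⊗ B ⇒ A′ ⊗ B′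
  f ⁂ g = ⟨ f ∘ π₁ , g ∘ π₂ ⟩

-- Preservation up to isomorphism: every product cone, not only the chosen
-- one, is sent to a product cone, which need not be the chosen one.
record FPFunctor (C : FPCategory o ℓ e) (D : FPCategory o′ ℓ′ e′) :
                 Set (o ⊔ ℓ ⊔ e ⊔ o′ ⊔ ℓ′ ⊔ e′) where
  private
    module C = FPCategory C
    module D = FPCategory D
  field
    functor : Functor C.category D.category
  open Functor functor public
  field
    preserves-terminal : ∀ {T} → IsTerminal C.category T →
                         IsTerminal D.category (F₀ T)
    preserves-product  : ∀ {A B P} {p : P C.⇒ A} {q : P C.⇒ B} →
                         IsProduct C.category p q →
                         IsProduct D.category (F₁ p) (F₁ q)

  -- The canonical isomorphism, inverse to ⟨ F₁ π₁ , F₁ π₂ ⟩.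
  ⊗-comparison⁻¹ : ∀ X Y → F₀ X D.⊗ F₀ Y D.⇒ F₀ (X C.⊗ Y)
  ⊗-comparison⁻¹ X Y =
    IsProduct.⟨_,_⟩ (preserves-product (C.⊗-product {X} {Y})) D.π₁ D.π₂

idFP : {C : FPCategory o ℓ e} → FPFunctor C C
idFP = record
  { functor            = idF
  ; preserves-terminal = λ t → t
  ; preserves-product  = λ p → p
  }

infixr 9 _∘FP_

_∘FP_ : {C : FPCategory o ℓ e} {D : FPCategory o′ ℓ′ e′}
        {E : FPCategory o″ ℓ″ e″} →
        FPFunctor D E → FPFunctor C D → FPFunctor C E
G ∘FP F = record
  { functor            = G.functor ∘F F.functor
  ; preserves-terminal = λ t → G.preserves-terminal (F.preserves-terminal t)
  ; preserves-product  = λ p → G.preserves-product (F.preserves-product p)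
  } where
    module F = FPFunctor F
    module G = FPFunctor G

------------------------------------------------------------------------
-- The category of Boolean algebras

record BooleanHomomorphism (A B : BooleanAlgebra b b) : Set b where
  private
    module A = BooleanAlgebra A
    module B = BooleanAlgebra B
  field
    ⟦_⟧                   : A.Carrier → B.Carrier
    isLatticeHomomorphism : IsLatticeHomomorphism A.rawLattice B.rawLattice ⟦_⟧
    ⊤-homo                : ⟦ A.⊤ ⟧ B.≈ B.⊤
    ⊥-homo                : ⟦ A.⊥ ⟧ B.≈ B.⊥
    ¬-homo                : ∀ x → ⟦ A.¬ x ⟧ B.≈ B.¬ ⟦ x ⟧
  open IsLatticeHomomorphism isLatticeHomomorphism public

open BooleanHomomorphism using (⟦_⟧)

BA : ∀ b → Category (suc b) b b
BA b = record
  { Obj       = BooleanAlgebra b b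
  ; _⇒_       = BooleanHomomorphism
  ; _≈_       = λ {A} {B} f g → ∀ x → _≈_ B (⟦ f ⟧ x) (⟦ g ⟧ x)
  ; id        = λ {A} → record
    { ⟦_⟧                   = λ x → x
    ; isLatticeHomomorphism =
        Identity.isLatticeHomomorphism (rawLattice A) (refl A)
    ; ⊤-homo                = refl A
    ; ⊥-homo                = refl A
    ; ¬-homo                = λ _ → refl A
    }
  ; _∘_       = λ {A} {B} {C} g f →
    let module f = BooleanHomomorphism f
        module g = BooleanHomomorphism g
    in record
    { ⟦_⟧                   = λ x → g.⟦ f.⟦ x ⟧ ⟧
    ; isLatticeHomomorphism =
        Composition.isLatticeHomomorphism (trans C)
          f.isLatticeHomomorphism g.isLatticeHomomorphism
    ; ⊤-homo                = trans C (g.⟦⟧-cong f.⊤-homo) g.⊤-homo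
    ; ⊥-homo                = trans C (g.⟦⟧-cong f.⊥-homo) g.⊥-homo
    ; ¬-homo                = λ x → trans C (g.⟦⟧-cong (f.¬-homo x)) (g.¬-homo _)
    }
  ; assoc     = λ {A} {B} {C} {D} _ → refl D
  ; identityˡ = λ {A} {B} _ → refl B
  ; identityʳ = λ {A} {B} _ → refl B
  ; equiv     = λ {A} {B} → record
    { refl  = λ _ → refl B
    ; sym   = λ p x → sym B (p x)
    ; trans = λ p q x → trans B (p x) (q x)
    }
  ; ∘-resp-≈  = λ {A} {B} {C} {f} {h} {g} {i} p q x →
      trans C (BooleanHomomorphism.⟦⟧-cong f (q x)) (p (⟦ i ⟧ x))
  } where open BooleanAlgebra

------------------------------------------------------------------------
-- Boolean doctrines and their morphisms

record BooleanDoctrine (C : FPCategory o ℓ e) (b : Level) :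
                       Set (o ⊔ ℓ ⊔ e ⊔ suc b) where
  private module C = FPCategory C
  field
    functor : Functor C.op (BA b)
  open Functor functor public

  module Fibre (X : C.Obj) where
    open BooleanAlgebra (F₀ X) public
    open Bundles.Poset (LatticeProperties.poset lattice) public using (_≤_)

  infix  4 _≈_ _≤_
  infixr 7 _∧_
  infix  10 _*

  Pred : C.Obj → Set b
  Pred = Fibre.Carrier

  _≈_ _≤_ : ∀ {X} → Rel (Pred X) b
  _≈_ {X} = Fibre._≈_ X
  _≤_ {X} = Fibre._≤_ X

  _∧_ : ∀ {X} → Pred X → Pred X → Pred X
  _∧_ {X} = Fibre._∧_ X

  ⊤ : ∀ {X} → Pred X
  ⊤ {X} = Fibre.⊤ X

  _* : ∀ {X Y} → X C.⇒ Y → Pred Y → Pred X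
  f * = ⟦ F₁ f ⟧

record DoctrineMorphism {C : FPCategory o ℓ e} {D : FPCategory o′ ℓ′ e′}
                        (P : BooleanDoctrine C b) (R : BooleanDoctrine D b) :
                        Set (o ⊔ ℓ ⊔ e ⊔ o′ ⊔ ℓ′ ⊔ e′ ⊔ b) where
  constructor ⟪_,_⟫
  field
    base : FPFunctor C D
    𝔪    : NaturalTransformation (BooleanDoctrine.functor P)
             (BooleanDoctrine.functor R ∘F Functor.opF (FPFunctor.functor base))
  open FPFunctor base public

  component : ∀ X → BooleanDoctrine.Pred P X → BooleanDoctrine.Pred R (F₀ X)
  component X = ⟦ NaturalTransformation.η 𝔪 X ⟧

infixr 9 _∘ᵈ_

_∘ᵈ_ : {C : FPCategory o ℓ e} {D : FPCategory o′ ℓ′ e′}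
       {E : FPCategory o″ ℓ″ e″}
       {P : BooleanDoctrine C b} {R : BooleanDoctrine D b}
       {S : BooleanDoctrine E b} →
       DoctrineMorphism R S → DoctrineMorphism P R → DoctrineMorphism P S
_∘ᵈ_ {b = b} {S = S} ⟪ N , 𝔫 ⟫ ⟪ M , 𝔪 ⟫ = ⟪ N ∘FP M , record
  { η       = λ X → 𝔫.η (M.F₀ X) ∘ 𝔪.η X
  ; commute = λ {X} {Y} f x →
      BooleanAlgebra.trans (BooleanDoctrine.F₀ S (N.F₀ (M.F₀ Y)))
        (BooleanHomomorphism.⟦⟧-cong (𝔫.η (M.F₀ Y)) (𝔪.commute f x))
        (𝔫.commute (M.F₁ f) (⟦ 𝔪.η X ⟧ x))
  } ⟫
  where
    module M = FPFunctor M
    module N = FPFunctor N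
    module 𝔪 = NaturalTransformation 𝔪
    module 𝔫 = NaturalTransformation 𝔫
    open Category (BA b) using (_∘_)

infix 4 _≈ᵈ_

-- Equality of (M , 𝔪) and (N , 𝔫) is strict: M and N agree on objects, and
-- modulo these identifications they agree on morphisms and 𝔪 agrees with 𝔫.
-- Proofs that products are preserved are not compared.
record _≈ᵈ_ {C : FPCategory o ℓ e} {D : FPCategory o′ ℓ′ e′}
            {P : BooleanDoctrine C b} {R : BooleanDoctrine D b}
            (F G : DoctrineMorphism P R) :
            Set (o ⊔ ℓ ⊔ o′ ⊔ e′ ⊔ b) where
  private
    module C = FPCategory C
    module D = FPCategory D
    module P = BooleanDoctrine P
    module R = BooleanDoctrine R
    module F = DoctrineMorphism F
    module G = DoctrineMorphism G
  field
    eq₀ : ∀ X → F.F₀ X ≡ G.F₀ X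
    eq₁ : ∀ {X Y} (f : X C.⇒ Y) →
          subst₂ D._⇒_ (eq₀ X) (eq₀ Y) (F.F₁ f) D.≈ G.F₁ f
    eq𝔪 : ∀ X (α : P.Pred X) →
          subst R.Pred (eq₀ X) (F.component X α) R.≈ G.component X α

------------------------------------------------------------------------
-- First-order Boolean doctrines and quantifier completions

record IsFirstOrder {C : FPCategory o ℓ e} (P : BooleanDoctrine C b) :
                    Set (o ⊔ ℓ ⊔ b) where
  open FPCategory C using (_⇒_; _⊗_; π₁; id; _⁂_)
  open BooleanDoctrine P
  field
    all            : ∀ X Y → Pred (X ⊗ Y) → Pred X
    all-mono       : ∀ X Y → Monotonic₁ (_≤_ {X ⊗ Y}) (_≤_ {X}) (all X Y)
    all-adjoint    : ∀ X Y → Adjoint (_≤_ {X}) (_≤_ {X ⊗ Y}) (π₁ *) (all X Y)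
    beck-chevalley : ∀ {X X′} (f : X′ ⇒ X) Y (α : Pred (X ⊗ Y)) →
                     (f *) (all X Y α) ≈ all X′ Y (((f ⁂ id) *) α)

-- M (X ⊗ Y) is identified with M X ⊗ M Y along the canonical isomorphism.
IsFirstOrderMorphism :
  {C : FPCategory o ℓ e} {D : FPCategory o′ ℓ′ e′}
  {P : BooleanDoctrine C b} {R : BooleanDoctrine D b} →
  IsFirstOrder P → IsFirstOrder R → DoctrineMorphism P R → Set (o ⊔ b)
IsFirstOrderMorphism {C = C} {P = P} {R = R} P-fo R-fo M =
  ∀ X Y (α : P.Pred (X ⊗ Y)) →
  component X (P-fo.all X Y α)
    R.≈ R-fo.all (F₀ X) (F₀ Y) ((⊗-comparison⁻¹ X Y R.*) (component (X ⊗ Y) α))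
  where
    open FPCategory C using (_⊗_)
    open DoctrineMorphism M
    module P = BooleanDoctrine P
    module R = BooleanDoctrine R
    module P-fo = IsFirstOrder P-fo
    module R-fo = IsFirstOrder R-fo

-- The base category of R ranges over all categories with finite products in
-- the same universe as those of P and Q.
record IsQuantifierCompletion
         {C C′ : FPCategory o ℓ e}
         {P : BooleanDoctrine C b} {Q : BooleanDoctrine C′ b}
         (I : DoctrineMorphism P Q) : Set (suc (o ⊔ ℓ ⊔ e ⊔ b)) where
  field
    isFirstOrder : IsFirstOrder Q
    universal    : ∀ {D : FPCategory o ℓ e} (R : BooleanDoctrine D b)
                   (R-fo : IsFirstOrder R) (M : DoctrineMorphism P R) →
                   ∃! _≈ᵈ_ λ (N : DoctrineMorphism Q R) →
                     IsFirstOrderMorphism isFirstOrder R-fo N × M ≈ᵈ N ∘ᵈ I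

------------------------------------------------------------------------
-- Elementary Boolean doctrines

record IsElementary {C : FPCategory o ℓ e} (P : BooleanDoctrine C b) :
                    Set (o ⊔ b) where
  open FPCategory C using (_⊗_; _∘_; Δ; π₁; π₂; ⟨_,_⟩)
  open BooleanDoctrine P
  field
    δ              : ∀ X → Pred (X ⊗ X)
    δ-reflexive    : ∀ X → ⊤ ≤ (Δ *) (δ X)
    δ-substitutive : ∀ X (α : Pred X) → (π₁ *) α ∧ δ X ≤ (π₂ *) α
    -- With X ⊗ Y ⊗ X ⊗ Y bracketed as (X ⊗ Y) ⊗ (X ⊗ Y), the four
    -- projections are π₁ ∘ π₁, π₂ ∘ π₁, π₁ ∘ π₂ and π₂ ∘ π₂.
    δ-product      : ∀ X Y →
                     (⟨ π₁ ∘ π₁ , π₁ ∘ π₂ ⟩ *) (δ X)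
                       ∧ (⟨ π₂ ∘ π₁ , π₂ ∘ π₂ ⟩ *) (δ Y)
                     ≤ δ (X ⊗ Y)

-- As above, M (X ⊗ X) is identified with M X ⊗ M X.
IsElementaryMorphism :
  {C : FPCategory o ℓ e} {D : FPCategory o′ ℓ′ e′}
  {P : BooleanDoctrine C b} {R : BooleanDoctrine D b} →
  IsElementary P → IsElementary R → DoctrineMorphism P R → Set (o ⊔ b)
IsElementaryMorphism {C = C} {R = R} P-el R-el M =
  ∀ X → (⊗-comparison⁻¹ X X R.*) (component (X ⊗ X) (P-el.δ X)) R.≈ R-el.δ (F₀ X)
  where
    open FPCategory C using (_⊗_)
    open DoctrineMorphism M
    module R = BooleanDoctrine R
    module P-el = IsElementary P-el
    module R-el = IsElementary R-el

{-# OPTIONS --safe #-}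

-- Put δ′ = 𝔦(δ).  The predicates α of P∀∃ along which δ′ can be substituted,
-- π₁*α ∧ δ′ ≤ π₂*α, contain the image of 𝔦 and are closed under the Boolean
-- operations, reindexing and universal quantification, so they form a
-- first-order Boolean doctrine R through which 𝔦 factors.  By the universal
-- property P∀∃ → R → P∀∃ is the identity, hence R is all of P∀∃.
module Submission where

open import Defs
open import Level using (Level; _⊔_)
open import Data.Product using (Σ; _,_; proj₁; proj₂)
open import Relation.Binary.PropositionalEquality using (_≡_; refl; subst)
open import Algebra.Lattice.Bundles using (BooleanAlgebra; RawLattice)
open import Algebra.Lattice.Morphism.Structures using (IsLatticeMonomorphism)
import Algebra.Lattice.Morphism.LatticeMonomorphism as LatticeMonomorphism
import Algebra.Lattice.Properties.BooleanAlgebra as BooleanAlgebraProperties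
import Algebra.Lattice.Properties.Lattice as LatticeProperties
import Relation.Binary.Lattice as OrderTheoretic
import Relation.Binary.Lattice.Properties.MeetSemilattice as MeetSemilatticeProperties
import Relation.Binary.Reasoning.PartialOrder as PartialOrderReasoning

private
  variable
    o ℓ e b : Level

-- Order-theoretic facts in a Boolean algebra.

module BooleanOrder (A : BooleanAlgebra b b) where
  open BooleanAlgebra A
  open BooleanAlgebraProperties A public
    using (∧-identityʳ; ∧-zeroˡ; ∨-identityˡ; ¬⊤≈⊥; ¬-involutive; deMorgan₁)
  open LatticeProperties lattice using (∧-orderTheoreticMeetSemilattice)
  open OrderTheoretic.MeetSemilattice ∧-orderTheoreticMeetSemilattice public
    using (poset; _≤_; x∧y≤x; x∧y≤y; ∧-greatest; antisym)
    renaming (refl to ≤-refl; reflexive to ≤-reflexive; trans to ≤-trans)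
  open MeetSemilatticeProperties ∧-orderTheoreticMeetSemilattice public
    using (∧-monotonic)
  open PartialOrderReasoning poset

  ≤⊤ : ∀ x → x ≤ ⊤
  ≤⊤ x = sym (∧-identityʳ x)

  -- Relative contraposition: splitting `¬ z ∧ y` along `x ∨ ¬ x` leaves only the `¬ x` part,
  -- because the `x` part lies below `¬ z ∧ z`. The side condition `y` will be the equality
  -- predicate.
  shunt-¬ : ∀ {x y z} → x ∧ y ≤ z → ¬ z ∧ y ≤ ¬ x
  shunt-¬ {x} {y} {z} x∧y≤z = begin
    ¬ z ∧ y                              ≈⟨ ∧-identityʳ _ ⟨
    (¬ z ∧ y) ∧ ⊤                        ≈⟨ ∧-congˡ (∨-complementʳ x) ⟨
    (¬ z ∧ y) ∧ (x ∨ ¬ x)                ≈⟨ ∧-distribˡ-∨ _ _ _ ⟩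
    ((¬ z ∧ y) ∧ x) ∨ ((¬ z ∧ y) ∧ ¬ x)  ≈⟨ ∨-congʳ disjoint ⟩
    ⊥ ∨ ((¬ z ∧ y) ∧ ¬ x)                ≈⟨ ∨-identityˡ _ ⟩
    (¬ z ∧ y) ∧ ¬ x                      ≤⟨ x∧y≤y _ _ ⟩
    ¬ x                                  ∎
    where
    disjoint : (¬ z ∧ y) ∧ x ≈ ⊥
    disjoint = antisym
      (begin
        (¬ z ∧ y) ∧ x  ≈⟨ ∧-assoc _ _ _ ⟩
        ¬ z ∧ (y ∧ x)  ≈⟨ ∧-congˡ (∧-comm _ _) ⟩
        ¬ z ∧ (x ∧ y)  ≤⟨ ∧-monotonic ≤-refl x∧y≤z ⟩
        ¬ z ∧ z        ≈⟨ ∧-complementˡ z ⟩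
        ⊥              ∎)
      (sym (∧-zeroˡ _))

  ∨≈¬[¬∧¬] : ∀ x y → ¬ (¬ x ∧ ¬ y) ≈ x ∨ y
  ∨≈¬[¬∧¬] x y = trans (deMorgan₁ _ _) (∨-cong (¬-involutive x) (¬-involutive y))

homo-mono : {A B : BooleanAlgebra b b} (h : BooleanHomomorphism A B)
            {x y : BooleanAlgebra.Carrier A} → BooleanOrder._≤_ A x y →
            BooleanOrder._≤_ B (BooleanHomomorphism.⟦_⟧ h x) (BooleanHomomorphism.⟦_⟧ h y)
homo-mono {B = B} h x≤y = BooleanAlgebra.trans B (⟦⟧-cong x≤y) (∧-homo _ _)
  where open BooleanHomomorphism h

-- Identities for pairing.

module ProductProperties (C : FPCategory o ℓ e) where
  open FPCategory C

  ⟨⟩-∘ : ∀ {X Y Z W} {f : Z ⇒ X} {g : Z ⇒ Y} {h : W ⇒ Z} →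
         ⟨ f , g ⟩ ∘ h ≈ ⟨ f ∘ h , g ∘ h ⟩
  ⟨⟩-∘ = ≈.sym (unique
    (≈.trans (≈.sym assoc) (∘-resp-≈ project₁ ≈.refl))
    (≈.trans (≈.sym assoc) (∘-resp-≈ project₂ ≈.refl)))

  ⟨⟩-cong : ∀ {X Y Z} {f f′ : Z ⇒ X} {g g′ : Z ⇒ Y} →
            f ≈ f′ → g ≈ g′ → ⟨ f , g ⟩ ≈ ⟨ f′ , g′ ⟩
  ⟨⟩-cong p q = unique (≈.trans project₁ (≈.sym p)) (≈.trans project₂ (≈.sym q))

  ⟨π₁,π₂⟩≈id : ∀ {X Y} → ⟨ π₁ {X} {Y} , π₂ ⟩ ≈ id
  ⟨π₁,π₂⟩≈id = unique identityʳ identityʳ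

  ⁂-⟨⟩ : ∀ {X Y X′ Y′ Z} {f : X ⇒ X′} {g : Y ⇒ Y′} {a : Z ⇒ X} {c : Z ⇒ Y} →
         (f ⁂ g) ∘ ⟨ a , c ⟩ ≈ ⟨ f ∘ a , g ∘ c ⟩
  ⁂-⟨⟩ = ≈.trans ⟨⟩-∘ (⟨⟩-cong
    (≈.trans assoc (∘-resp-≈ ≈.refl project₁))
    (≈.trans assoc (∘-resp-≈ ≈.refl project₂)))

-- Calculus of reindexing and quantification in a doctrine.

module DoctrineProperties {C : FPCategory o ℓ e} (R : BooleanDoctrine C b) where
  private
    module C = FPCategory C
  open BooleanDoctrine R
  open C using (_⇒_; _⊗_; π₁; id; _∘_)

  module F {X : C.Obj} where
    open Fibre X public
      using (refl; sym; trans; reflexive; ∧-cong; ∧-congˡ; ∧-congʳ; ∧-comm; ¬_)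
    open BooleanOrder (F₀ X) public

  module ≤-Reasoning (X : C.Obj) = PartialOrderReasoning (F.poset {X})

  module * {X Y : C.Obj} (f : X ⇒ Y) = BooleanHomomorphism (F₁ f)

  *-mono : ∀ {X Y} (f : X ⇒ Y) {α β : Pred Y} → α ≤ β → (f *) α ≤ (f *) β
  *-mono f = homo-mono (F₁ f)

  *-resp-≈ : ∀ {X Y} {f g : X ⇒ Y} → f C.≈ g → ∀ {α} → (f *) α ≈ (g *) α
  *-resp-≈ p = F-resp-≈ p _

  *-id : ∀ {X} {α : Pred X} → (id *) α ≈ α
  *-id = identity _

  *-∘ : ∀ {X Y Z} {f : X ⇒ Y} {g : Y ⇒ Z} {h : X ⇒ Z} → g ∘ f C.≈ h →
        ∀ {α} → (f *) ((g *) α) ≈ (h *) α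
  *-∘ {f = f} {g} p {α} =
    F.trans (F.sym (homomorphism {f = g} {g = f} α)) (*-resp-≈ p)

  ∧-intro-⊤ : ∀ {X} {α β : Pred X} → ⊤ ≤ β → α ≤ α ∧ β
  ∧-intro-⊤ ⊤≤β = F.∧-greatest F.≤-refl (F.≤-trans (F.≤⊤ _) ⊤≤β)

  module FirstOrder (R-fo : IsFirstOrder R) where
    open IsFirstOrder R-fo

    all-cong : ∀ X Y {α β : Pred (X ⊗ Y)} → α ≈ β → all X Y α ≈ all X Y β
    all-cong X Y p = F.antisym (all-mono X Y (F.≤-reflexive p))
                               (all-mono X Y (F.≤-reflexive (F.sym p)))

    all-counit : ∀ X Y {α : Pred (X ⊗ Y)} → (π₁ *) (all X Y α) ≤ α
    all-counit X Y = proj₂ (all-adjoint X Y) F.≤-refl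

-- Subdoctrines cut out by a family of predicates.

module _ {C : FPCategory o ℓ e} (Q : BooleanDoctrine C b) where
  private
    module C = FPCategory C
    module Q = BooleanDoctrine Q
  open C using (_⇒_)

  -- Closure under `⊥` and `∨` follows from these fields, through `¬⊤≈⊥` and De Morgan. `S` is
  -- valued in `Set b` so that the fibres stay at the level of those of `Q`, as the universal
  -- property demands of its targets.
  record IsSubdoctrine (S : ∀ {X} → Q.Pred X → Set b) : Set (o ⊔ ℓ ⊔ b) where
    field
      S-resp-≈ : ∀ {X} {α β : Q.Pred X} → α Q.≈ β → S α → S β
      S-⊤      : ∀ {X} → S (Q.⊤ {X})
      S-∧      : ∀ {X} {α β : Q.Pred X} → S α → S β → S (α Q.∧ β)
      S-¬      : ∀ {X} {α : Q.Pred X} → S α → S (Q.Fibre.¬_ X α)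
      S-*      : ∀ {X Y} (f : X ⇒ Y) {α : Q.Pred Y} → S α → S ((f Q.*) α)

module Subdoctrine {C : FPCategory o ℓ e} (Q : BooleanDoctrine C b)
                   {S : ∀ {X} → BooleanDoctrine.Pred Q X → Set b}
                   (isSubdoctrine : IsSubdoctrine Q S) where
  private
    module C = FPCategory C
    module Q = BooleanDoctrine Q
    module QP = DoctrineProperties Q
  open C using (_⊗_)
  open IsSubdoctrine isSubdoctrine
  open BooleanHomomorphism using (⟦_⟧)

  module _ (X : C.Obj) where
    private module A = Q.Fibre X

    -- Equality ignores the membership proofs. This makes `proj₁` injective, so the lattice laws are
    -- pulled back along it.
    sub-rawLattice : RawLattice b b
    sub-rawLattice = record
      { Carrier = Σ (Q.Pred X) S
      ; _≈_     = λ x y → proj₁ x A.≈ proj₁ y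
      ; _∧_     = λ (α , s) (β , t) → α A.∧ β , S-∧ s t
      ; _∨_     = λ (α , s) (β , t) →
          α A.∨ β , S-resp-≈ (QP.F.∨≈¬[¬∧¬] α β) (S-¬ (S-∧ (S-¬ s) (S-¬ t)))
      }

    proj₁-isLatticeMonomorphism : IsLatticeMonomorphism sub-rawLattice A.rawLattice proj₁
    proj₁-isLatticeMonomorphism = record
      { isLatticeHomomorphism = record
        { isRelHomomorphism = record { cong = λ p → p }
        ; ∧-homo            = λ _ _ → A.refl
        ; ∨-homo            = λ _ _ → A.refl
        }
      ; injective = λ p → p
      }

    subalgebra : BooleanAlgebra b b
    subalgebra = record
      { RawLattice sub-rawLattice
      ; ¬_ = λ (α , s) → A.¬ α , S-¬ s
      ; ⊤  = A.⊤ , S-⊤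
      ; ⊥  = A.⊥ , S-resp-≈ QP.F.¬⊤≈⊥ (S-¬ S-⊤)
      ; isBooleanAlgebra = record
        { isDistributiveLattice =
            LatticeMonomorphism.isDistributiveLattice
              proj₁-isLatticeMonomorphism A.isDistributiveLattice
        ; ∨-complement =
            (λ x → A.∨-complementˡ (proj₁ x)) , λ x → A.∨-complementʳ (proj₁ x)
        ; ∧-complement =
            (λ x → A.∧-complementˡ (proj₁ x)) , λ x → A.∧-complementʳ (proj₁ x)
        ; ¬-cong = A.¬-cong
        }
      }

    subalgebra-inclusion : BooleanHomomorphism subalgebra (Q.F₀ X)
    subalgebra-inclusion = record
      { ⟦_⟧    = proj₁
      ; isLatticeHomomorphism =
          IsLatticeMonomorphism.isLatticeHomomorphism proj₁-isLatticeMonomorphism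
      ; ⊤-homo = A.refl
      ; ⊥-homo = A.refl
      ; ¬-homo = λ _ → A.refl
      }

  corestrict : {A : BooleanAlgebra b b} {X : C.Obj} (h : BooleanHomomorphism A (Q.F₀ X)) →
               (∀ x → S (⟦ h ⟧ x)) → BooleanHomomorphism A (subalgebra X)
  corestrict h s = record
    { ⟦_⟧    = λ x → ⟦ h ⟧ x , s x
    ; isLatticeHomomorphism = record
      { isRelHomomorphism = record { cong = ⟦⟧-cong }
      ; ∧-homo            = ∧-homo
      ; ∨-homo            = ∨-homo
      }
    ; ⊤-homo = ⊤-homo
    ; ⊥-homo = ⊥-homo
    ; ¬-homo = ¬-homo
    } where open BooleanHomomorphism h hiding (⟦_⟧)

  subdoctrine : BooleanDoctrine C b
  subdoctrine = record
    { functor = record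
      { F₀           = subalgebra
      ; F₁           = λ {Y} {X} f →
          corestrict (Category._∘_ (BA b) (Q.F₁ f) (subalgebra-inclusion Y))
                     (λ x → S-* f (proj₂ x))
      ; identity     = λ x → Q.identity (proj₁ x)
      ; homomorphism = λ x → Q.homomorphism (proj₁ x)
      ; F-resp-≈     = λ p x → Q.F-resp-≈ p (proj₁ x)
      }
    }

  inclusion : DoctrineMorphism subdoctrine Q
  inclusion = ⟪ idFP , record
    { η       = subalgebra-inclusion
    ; commute = λ _ _ → QP.F.refl
    } ⟫

  module _ (Q-fo : IsFirstOrder Q) where
    open IsFirstOrder Q-fo

    -- The order of the subdoctrine is by definition that of `Q` on first components, so the
    -- quantifiers of `Q` keep their laws once they preserve `S`.
    subdoctrine-isFirstOrder :
      (∀ X Y {α : Q.Pred (X ⊗ Y)} → S α → S (all X Y α)) →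
      IsFirstOrder subdoctrine
    subdoctrine-isFirstOrder S-all = record
      { all            = λ X Y (α , s) → all X Y α , S-all X Y s
      ; all-mono       = λ X Y → all-mono X Y
      ; all-adjoint    = λ X Y → all-adjoint X Y
      ; beck-chevalley = λ f Y (α , _) → beck-chevalley f Y α
      }

  -- `_≈ᵈ_` transports components along equalities of objects, and in the subdoctrine this moves a
  -- whole pair. Here the transport is read off in `Q`.
  subst-proj₁ : ∀ {X Y} (p : X ≡ Y) (x : Σ (Q.Pred X) S) →
                proj₁ (subst (λ Z → Σ (Q.Pred Z) S) p x) ≡ subst Q.Pred p (proj₁ x)
  subst-proj₁ refl _ = refl

  S-subst : ∀ {X Y} (p : X ≡ Y) {α : Q.Pred X} → S α → S (subst Q.Pred p α)
  S-subst refl s = s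

  S-subst⁻¹ : ∀ {X Y} (p : X ≡ Y) {α : Q.Pred X} → S (subst Q.Pred p α) → S α
  S-subst⁻¹ refl s = s

-- An induction principle for quantifier completions.

module _ {C C′ : FPCategory o ℓ e} {P : BooleanDoctrine C b} {Q : BooleanDoctrine C′ b}
         {I : DoctrineMorphism P Q} (I-completion : IsQuantifierCompletion I)
         {S : ∀ {X} → BooleanDoctrine.Pred Q X → Set b}
         (isSubdoctrine : IsSubdoctrine Q S) where
  private
    module C′ = FPCategory C′
    module P = BooleanDoctrine P
    module Q = BooleanDoctrine Q
    module QP = DoctrineProperties Q
    module PP = ProductProperties C′
    module I = DoctrineMorphism I
  open C′ using (_⊗_)
  open IsQuantifierCompletion I-completion
  open IsFirstOrder isFirstOrder using (all)
  open IsSubdoctrine isSubdoctrine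
  open Subdoctrine Q isSubdoctrine

  idᵈ : DoctrineMorphism Q Q
  idᵈ = ⟪ idFP , record
    { η       = λ X → Category.id (BA b) {Q.F₀ X}
    ; commute = λ _ _ → QP.F.refl
    } ⟫

  -- The comparison map of the identity functor is `⟨ π₁ , π₂ ⟩`, equal to `id` only up to `≈`;
  -- hence the rewriting under the quantifier.
  idᵈ-isFirstOrderMorphism : IsFirstOrderMorphism isFirstOrder isFirstOrder idᵈ
  idᵈ-isFirstOrderMorphism X Y α = QP.FirstOrder.all-cong isFirstOrder X Y
    (QP.F.sym (QP.F.trans (QP.*-resp-≈ PP.⟨π₁,π₂⟩≈id) QP.*-id))

  -- The predicates of `Q` are generated by the image of `I`: the extension `N` of the corestricted
  -- `I` takes values in `S`, while uniqueness makes it the identity after inclusion.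
  completion-induction :
    (∀ X Y {α : Q.Pred (X ⊗ Y)} → S α → S (all X Y α)) →
    (∀ X (α : P.Pred X) → S (I.component X α)) →
    ∀ {X} (α : Q.Pred X) → S α
  completion-induction S-all S-I {X} α =
    -- From the inside out: the value of `N` at `α` carries a proof of `S`, which passes to the
    -- value of the chosen extension `N₀` and from there to `α`. The two transports undo the
    -- identifications of objects in the two equalities.
    S-resp-≈ (N₀≈id.eq𝔪 X α)
      (S-subst (N₀≈id.eq₀ X)
        (S-subst⁻¹ (N₀≈JN.eq₀ X)
          (S-resp-≈ (QP.F.sym (N₀≈JN.eq𝔪 X α)) (proj₂ (N.component X α)))))
    where
    S-fo = subdoctrine-isFirstOrder isFirstOrder S-all

    I′ : DoctrineMorphism P subdoctrine
    I′ = ⟪ I.base , record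
      { η       = λ X → corestrict (NaturalTransformation.η I.𝔪 X) (S-I X)
      ; commute = NaturalTransformation.commute I.𝔪
      } ⟫

    N-universal = universal subdoctrine S-fo I′
    N = proj₁ N-universal
    module N = DoctrineMorphism N
    N-fo = proj₁ (proj₁ (proj₂ N-universal))
    module I′≈NI = _≈ᵈ_ (proj₂ (proj₁ (proj₂ N-universal)))

    -- `∃!` compares a candidate only with the chosen witness `N₀`, so the identity and
    -- `inclusion ∘ᵈ N` are each compared with it.
    N₀-unique = proj₂ (proj₂ (universal Q isFirstOrder I))

    I≈id∘I : I ≈ᵈ idᵈ ∘ᵈ I
    I≈id∘I = record
      { eq₀ = λ _ → refl
      ; eq₁ = λ _ → C′.≈.refl
      ; eq𝔪 = λ _ _ → QP.F.refl
      }

    I≈JN∘I : I ≈ᵈ (inclusion ∘ᵈ N) ∘ᵈ I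
    I≈JN∘I = record
      { eq₀ = I′≈NI.eq₀
      ; eq₁ = I′≈NI.eq₁
      ; eq𝔪 = λ X α → QP.F.trans
          (QP.F.sym (QP.F.reflexive (subst-proj₁ (I′≈NI.eq₀ X) _)))
          (I′≈NI.eq𝔪 X α)
      }

    module N₀≈id = _≈ᵈ_ (N₀-unique {idᵈ} (idᵈ-isFirstOrderMorphism , I≈id∘I))
    -- `N-fo` also shows that `inclusion ∘ᵈ N` is first-order: equality in the subdoctrine is
    -- equality of first components, and its quantifiers are those of `Q` there.
    module N₀≈JN = _≈ᵈ_ (N₀-unique {inclusion ∘ᵈ N} (N-fo , I≈JN∘I))

-- Predicates that can be substituted along a given family of relations.

RelationFamily : {C : FPCategory o ℓ e} → BooleanDoctrine C b → Set (o ⊔ b)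
RelationFamily {C = C} R = ∀ X → BooleanDoctrine.Pred R (X ⊗ X)
  where open FPCategory C using (_⊗_)

-- The properties of a fibered equality that involve no predicate besides the
-- equality itself; unlike δ-substitutive, they pass along doctrine morphisms.
record IsPreEquality {C : FPCategory o ℓ e} (R : BooleanDoctrine C b)
                     (δ : RelationFamily R) : Set (o ⊔ ℓ ⊔ b) where
  open FPCategory C using (_⇒_; _⊗_; _∘_; Δ; π₁; π₂; ⟨_,_⟩; _⁂_)
  open BooleanDoctrine R
  field
    δ-reflexive : ∀ X → ⊤ ≤ (Δ *) (δ X)
    δ-symmetric : ∀ X → δ X ≤ (⟨ π₂ , π₁ ⟩ *) (δ X)
    δ-congruent : ∀ {X Y} (f : X ⇒ Y) → δ X ≤ ((f ⁂ f) *) (δ Y)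
    δ-product   : ∀ X Y →
                  (⟨ π₁ ∘ π₁ , π₁ ∘ π₂ ⟩ *) (δ X)
                    ∧ (⟨ π₂ ∘ π₁ , π₂ ∘ π₂ ⟩ *) (δ Y)
                  ≤ δ (X ⊗ Y)

module Equality {C : FPCategory o ℓ e} (R : BooleanDoctrine C b)
                (δ : RelationFamily R) where
  open FPCategory C hiding (_≈_)
  open BooleanDoctrine R
  open ProductProperties C
  open DoctrineProperties R
  private module C = FPCategory C

  infix 8 _≐_

  -- Equality of two terms in context `Z`; it allows the arguments below to follow internal
  -- first-order reasoning.
  _≐_ : ∀ {X Z} → Z ⇒ X → Z ⇒ X → Pred Z
  a ≐ c = (⟨ a , c ⟩ *) (δ _)

  Substitutive : ∀ {X} → Pred X → Set b
  Substitutive {X} α = (π₁ *) α ∧ δ X ≤ (π₂ *) α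

  π₁≐π₂ : ∀ {X} → π₁ ≐ π₂ ≈ δ X
  π₁≐π₂ = F.trans (*-resp-≈ ⟨π₁,π₂⟩≈id) *-id

  ≐-* : ∀ {X Z W} {a c : Z ⇒ X} (h : W ⇒ Z) → (h *) (a ≐ c) ≈ a ∘ h ≐ c ∘ h
  ≐-* _ = *-∘ ⟨⟩-∘

  -- `Substitutive` is the generic case, with terms `π₁` and `π₂`; reindexing it along `⟨ a , c ⟩`
  -- gives all the others.
  ≐-subst : ∀ {X Z} {α : Pred X} → Substitutive α →
            (a c : Z ⇒ X) → (a *) α ∧ a ≐ c ≤ (c *) α
  ≐-subst {X} {Z} {α} s a c = begin
    (a *) α ∧ a ≐ c           ≈⟨ F.∧-congʳ (*-∘ project₁) ⟨
    (h *) ((π₁ *) α) ∧ a ≐ c  ≈⟨ *.∧-homo h _ _ ⟨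
    (h *) ((π₁ *) α ∧ δ X)    ≤⟨ *-mono h s ⟩
    (h *) ((π₂ *) α)          ≈⟨ *-∘ project₂ ⟩
    (c *) α                   ∎
    where
    open ≤-Reasoning Z
    h = ⟨ a , c ⟩

  module _ (δ-reflexive : ∀ X → ⊤ ≤ (Δ *) (δ X)) where

    ≐-refl : ∀ {X Z} (a : Z ⇒ X) → ⊤ ≤ a ≐ a
    ≐-refl {X} {Z} a = begin
      ⊤                    ≈⟨ *.⊤-homo a ⟨
      (a *) ⊤              ≤⟨ *-mono a (δ-reflexive X) ⟩
      (a *) ((Δ *) (δ X))  ≈⟨ *-∘ (≈.trans ⟨⟩-∘ (⟨⟩-cong identityˡ identityˡ)) ⟩
      a ≐ a                ∎
      where open ≤-Reasoning Z

  module _ (δ-product : ∀ X Y →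
              (⟨ π₁ ∘ π₁ , π₁ ∘ π₂ ⟩ *) (δ X) ∧ (⟨ π₂ ∘ π₁ , π₂ ∘ π₂ ⟩ *) (δ Y)
              ≤ δ (X ⊗ Y)) where

    ≐-pair : ∀ {X Y Z} (a c : Z ⇒ X) (a′ c′ : Z ⇒ Y) →
             a ≐ c ∧ a′ ≐ c′ ≤ ⟨ a , a′ ⟩ ≐ ⟨ c , c′ ⟩
    ≐-pair {X} {Y} {Z} a c a′ c′ = begin
      a ≐ c ∧ a′ ≐ c′
        ≈⟨ F.∧-cong
             (*-∘ (≈.trans ⟨⟩-∘ (⟨⟩-cong (∘₁ project₁) (∘₂ project₁))))
             (*-∘ (≈.trans ⟨⟩-∘ (⟨⟩-cong (∘₁ project₂) (∘₂ project₂)))) ⟨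
      (h *) ((⟨ π₁ ∘ π₁ , π₁ ∘ π₂ ⟩ *) (δ X)) ∧ (h *) ((⟨ π₂ ∘ π₁ , π₂ ∘ π₂ ⟩ *) (δ Y))
        ≈⟨ *.∧-homo h _ _ ⟨
      (h *) ((⟨ π₁ ∘ π₁ , π₁ ∘ π₂ ⟩ *) (δ X) ∧ (⟨ π₂ ∘ π₁ , π₂ ∘ π₂ ⟩ *) (δ Y))
        ≤⟨ *-mono h (δ-product X Y) ⟩
      ⟨ a , a′ ⟩ ≐ ⟨ c , c′ ⟩ ∎
      where
      open ≤-Reasoning Z
      h = ⟨ ⟨ a , a′ ⟩ , ⟨ c , c′ ⟩ ⟩

      ∘₁ : ∀ {V} {g : X ⊗ Y ⇒ V} {k : Z ⇒ V} →
           g ∘ ⟨ a , a′ ⟩ C.≈ k → (g ∘ π₁) ∘ h C.≈ k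
      ∘₁ p = ≈.trans assoc (≈.trans (∘-resp-≈ ≈.refl project₁) p)

      ∘₂ : ∀ {V} {g : X ⊗ Y ⇒ V} {k : Z ⇒ V} →
           g ∘ ⟨ c , c′ ⟩ C.≈ k → (g ∘ π₂) ∘ h C.≈ k
      ∘₂ p = ≈.trans assoc (≈.trans (∘-resp-≈ ≈.refl project₂) p)

  module PreEquality (isPreEquality : IsPreEquality R δ) where
    open IsPreEquality isPreEquality

    substitutive-isSubdoctrine : IsSubdoctrine R Substitutive
    substitutive-isSubdoctrine = record
      { S-resp-≈ = λ {X} {α} {β} p s → let open ≤-Reasoning (X ⊗ X) in begin
          (π₁ *) β ∧ δ X  ≈⟨ F.∧-congʳ (*.⟦⟧-cong π₁ p) ⟨
          (π₁ *) α ∧ δ X  ≤⟨ s ⟩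
          (π₂ *) α        ≈⟨ *.⟦⟧-cong π₂ p ⟩
          (π₂ *) β        ∎
      ; S-⊤ = F.≤-trans (F.≤⊤ _) (F.≤-reflexive (F.sym (*.⊤-homo π₂)))
      ; S-∧ = λ {X} {α} {β} s t → let open ≤-Reasoning (X ⊗ X) in begin
          (π₁ *) (α ∧ β) ∧ δ X
            ≈⟨ F.∧-congʳ (*.∧-homo π₁ α β) ⟩
          ((π₁ *) α ∧ (π₁ *) β) ∧ δ X
            ≤⟨ F.∧-greatest
                 (F.≤-trans (F.∧-monotonic (F.x∧y≤x _ _) F.≤-refl) s)
                 (F.≤-trans (F.∧-monotonic (F.x∧y≤y _ _) F.≤-refl) t) ⟩
          (π₂ *) α ∧ (π₂ *) β
            ≈⟨ *.∧-homo π₂ α β ⟨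
          (π₂ *) (α ∧ β) ∎
      -- Negation reverses the direction of substitution: symmetry turns the equality around, `α` is
      -- carried from `π₂` back to `π₁`, and `shunt-¬` contraposes.
      ; S-¬ = λ {X} {α} s → let open ≤-Reasoning (X ⊗ X) in begin
          (π₁ *) (F.¬ α) ∧ δ X
            ≈⟨ F.∧-congʳ (*.¬-homo π₁ α) ⟩
          F.¬ (π₁ *) α ∧ δ X
            ≤⟨ F.shunt-¬ (F.≤-trans (F.∧-monotonic F.≤-refl (δ-symmetric X))
                                     (≐-subst s π₂ π₁)) ⟩
          F.¬ (π₂ *) α
            ≈⟨ *.¬-homo π₂ α ⟨
          (π₂ *) (F.¬ α) ∎
      -- From x = x′ congruence gives f x = f x′, along which `α` itself is substituted.
      ; S-* = λ {X} {Y} f {α} s → let open ≤-Reasoning (X ⊗ X) in begin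
          (π₁ *) ((f *) α) ∧ δ X
            ≤⟨ F.∧-monotonic (F.≤-reflexive (*-∘ ≈.refl)) (δ-congruent f) ⟩
          ((f ∘ π₁) *) α ∧ f ∘ π₁ ≐ f ∘ π₂
            ≤⟨ ≐-subst s (f ∘ π₁) (f ∘ π₂) ⟩
          ((f ∘ π₂) *) α
            ≈⟨ *-∘ ≈.refl ⟨
          (π₂ *) ((f *) α) ∎
      }

    -- By Beck-Chevalley and adjointness it suffices to argue in the context of x, x′ and y. There
    -- the hypothesis gives α(x, y), and x = x′ together with y = y gives (x, y) = (x′, y). The
    -- assumption on `α` concerns equality on `X ⊗ Y`, which is where `δ-product` enters.
    substitutive-all : (R-fo : IsFirstOrder R) → ∀ X Y {α : Pred (X ⊗ Y)} →
                       Substitutive α → Substitutive (IsFirstOrder.all R-fo X Y α)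
    substitutive-all R-fo X Y {α} s = let open ≤-Reasoning (X ⊗ X) in begin
      (π₁ *) (all X Y α) ∧ δ X            ≤⟨ proj₁ (all-adjoint (X ⊗ X) Y) adjunct ⟩
      all (X ⊗ X) Y (((π₂ ⁂ id) *) α)     ≈⟨ beck-chevalley π₂ Y α ⟨
      (π₂ *) (all X Y α)                  ∎
      where
      open IsFirstOrder R-fo
      open FirstOrder R-fo

      a c : (X ⊗ X) ⊗ Y ⇒ X
      a = π₁ ∘ π₁
      c = π₂ ∘ π₁

      y : (X ⊗ X) ⊗ Y ⇒ Y
      y = π₂

      instantiate : (π₁ *) ((π₁ *) (all X Y α)) ≤ (⟨ a , y ⟩ *) α
      instantiate = let open ≤-Reasoning ((X ⊗ X) ⊗ Y) in begin
        (π₁ *) ((π₁ *) (all X Y α))         ≈⟨ *-∘ ≈.refl ⟩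
        (a *) (all X Y α)                   ≈⟨ *-∘ project₁ ⟨
        -- The counit, reindexed along `⟨ a , y ⟩`, instantiates the quantified variable at `y`.
        (⟨ a , y ⟩ *) ((π₁ *) (all X Y α))  ≤⟨ *-mono ⟨ a , y ⟩ (all-counit X Y) ⟩
        (⟨ a , y ⟩ *) α                     ∎

      adjunct : (π₁ *) ((π₁ *) (all X Y α) ∧ δ X) ≤ ((π₂ ⁂ id) *) α
      adjunct = let open ≤-Reasoning ((X ⊗ X) ⊗ Y) in begin
        (π₁ *) ((π₁ *) (all X Y α) ∧ δ X)
          ≈⟨ *.∧-homo π₁ _ _ ⟩
        (π₁ *) ((π₁ *) (all X Y α)) ∧ (π₁ *) (δ X)
          ≈⟨ F.∧-congˡ (F.trans (*.⟦⟧-cong π₁ (F.sym π₁≐π₂)) (≐-* π₁)) ⟩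
        (π₁ *) ((π₁ *) (all X Y α)) ∧ a ≐ c
          ≤⟨ F.∧-monotonic instantiate
               (F.≤-trans (∧-intro-⊤ (≐-refl δ-reflexive y))
                          (≐-pair δ-product a c y y)) ⟩
        (⟨ a , y ⟩ *) α ∧ ⟨ a , y ⟩ ≐ ⟨ c , y ⟩
          ≤⟨ ≐-subst s ⟨ a , y ⟩ ⟨ c , y ⟩ ⟩
        (⟨ c , y ⟩ *) α
          ≈⟨ *-resp-≈ (⟨⟩-cong ≈.refl identityˡ) ⟨
        ((π₂ ⁂ id) *) α ∎

-- Path induction for a fibered equality.

module _ {C : FPCategory o ℓ e} {P : BooleanDoctrine C b} (P-el : IsElementary P) where
  open FPCategory C hiding (_≈_)
  open BooleanDoctrine P
  open ProductProperties C
  open DoctrineProperties P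
  open IsElementary P-el
  open Equality P δ

  -- Path induction: x = y transports β(x, x) to β(x, y) along the equality
  -- (x, x) = (x, y) on X ⊗ X.
  δ-least-reflexive : ∀ {X} (β : Pred (X ⊗ X)) → ⊤ ≤ (Δ *) β → δ X ≤ β
  δ-least-reflexive {X} β ⊤≤Δ*β = begin
    δ X
      ≤⟨ F.∧-greatest (F.≤-trans (F.≤⊤ _) diagonal) pair ⟩
    (⟨ π₁ , π₁ ⟩ *) β ∧ ⟨ π₁ , π₁ ⟩ ≐ ⟨ π₁ , π₂ ⟩
      ≤⟨ ≐-subst (δ-substitutive (X ⊗ X) β) ⟨ π₁ , π₁ ⟩ ⟨ π₁ , π₂ ⟩ ⟩
    (⟨ π₁ , π₂ ⟩ *) β
      ≈⟨ F.trans (*-resp-≈ ⟨π₁,π₂⟩≈id) *-id ⟩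
    β ∎
    where
    open ≤-Reasoning (X ⊗ X)

    diagonal : ⊤ ≤ (⟨ π₁ , π₁ ⟩ *) β
    diagonal = begin
      ⊤                    ≈⟨ *.⊤-homo π₁ ⟨
      (π₁ *) ⊤             ≤⟨ *-mono π₁ ⊤≤Δ*β ⟩
      (π₁ *) ((Δ *) β)     ≈⟨ *-∘ (≈.trans ⟨⟩-∘ (⟨⟩-cong identityˡ identityˡ)) ⟩
      (⟨ π₁ , π₁ ⟩ *) β    ∎

    pair : δ X ≤ ⟨ π₁ , π₁ ⟩ ≐ ⟨ π₁ , π₂ ⟩
    pair = begin
      δ X                           ≈⟨ π₁≐π₂ ⟨
      π₁ ≐ π₂                       ≤⟨ ∧-intro-⊤ (≐-refl δ-reflexive π₁) ⟩
      π₁ ≐ π₂ ∧ π₁ ≐ π₁             ≈⟨ F.∧-comm _ _ ⟩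
      π₁ ≐ π₁ ∧ π₁ ≐ π₂             ≤⟨ ≐-pair δ-product π₁ π₁ π₁ π₂ ⟩
      ⟨ π₁ , π₁ ⟩ ≐ ⟨ π₁ , π₂ ⟩     ∎

  -- On the diagonal the symmetry and congruence goals reduce to reflexivity. They are proved in
  -- `P`, where every predicate is substitutive; in the completion, path induction would presuppose
  -- the conclusion.
  elementary⇒preEquality : IsPreEquality P δ
  elementary⇒preEquality = record
    { δ-reflexive = δ-reflexive
    ; δ-symmetric = λ X → δ-least-reflexive _
        (F.≤-trans (≐-refl δ-reflexive id)
          (F.≤-reflexive (F.sym (*-∘ (≈.trans ⟨⟩-∘ (⟨⟩-cong project₂ project₁))))))
    ; δ-congruent = λ f → δ-least-reflexive _
        (F.≤-trans (≐-refl δ-reflexive (f ∘ id))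
          (F.≤-reflexive (F.sym (*-∘ ⁂-⟨⟩))))
    ; δ-product   = δ-product
    }

-- Transport along a doctrine morphism over the identity functor.

module _ {C : FPCategory o ℓ e} {P Q : BooleanDoctrine C b}
         (𝔦 : NaturalTransformation (BooleanDoctrine.functor P)
                (BooleanDoctrine.functor Q ∘F Functor.opF idF)) where
  open FPCategory C hiding (_≈_)
  private
    module P = BooleanDoctrine P
  open BooleanDoctrine Q
  open DoctrineProperties Q
  open NaturalTransformation 𝔦
  private
    module 𝔦 X = BooleanHomomorphism (η X)

  transport-* : ∀ {X Y} (f : X ⇒ Y) {α β} → α P.≤ (f P.*) β →
                𝔦.⟦_⟧ X α ≤ (f *) (𝔦.⟦_⟧ Y β)
  transport-* {X} f p =
    F.≤-trans (homo-mono (η X) p) (F.≤-reflexive (commute f _))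

  -- This is the base case of the induction: naturality moves the reindexings through `𝔦`, so
  -- substitutivity in `P` passes to the image of `𝔦`.
  transport-substitutive :
    ∀ {δ : RelationFamily P} {X} {α : P.Pred X} →
    Equality.Substitutive P δ α →
    Equality.Substitutive Q (λ X → 𝔦.⟦_⟧ (X ⊗ X) (δ X)) (𝔦.⟦_⟧ X α)
  transport-substitutive {δ} {X} {α} s = begin
    (π₁ *) (𝔦.⟦_⟧ X α) ∧ 𝔦.⟦_⟧ (X ⊗ X) (δ X)
      ≈⟨ F.∧-congʳ (commute π₁ α) ⟨
    𝔦.⟦_⟧ (X ⊗ X) ((π₁ P.*) α) ∧ 𝔦.⟦_⟧ (X ⊗ X) (δ X)
      ≈⟨ 𝔦.∧-homo (X ⊗ X) _ _ ⟨
    𝔦.⟦_⟧ (X ⊗ X) ((π₁ P.*) α P.∧ δ X)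
      ≤⟨ transport-* π₂ s ⟩
    (π₂ *) (𝔦.⟦_⟧ X α) ∎
    where open ≤-Reasoning (X ⊗ X)

  transport-preEquality :
    ∀ {δ : RelationFamily P} → IsPreEquality P δ →
    IsPreEquality Q (λ X → 𝔦.⟦_⟧ (X ⊗ X) (δ X))
  transport-preEquality {δ} pre = record
    { δ-reflexive = λ X →
        F.≤-trans (F.≤-reflexive (F.sym (𝔦.⊤-homo X))) (transport-* Δ (δ-reflexive X))
    ; δ-symmetric = λ X → transport-* _ (δ-symmetric X)
    ; δ-congruent = λ f → transport-* _ (δ-congruent f)
    ; δ-product   = λ X Y → F.≤-trans
        (F.≤-reflexive (F.trans
          (F.∧-cong (F.sym (commute _ (δ X))) (F.sym (commute _ (δ Y))))
          (F.sym (𝔦.∧-homo _ _ _))))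
        (homo-mono (η _) (δ-product X Y))
    }
    where open IsPreEquality pre

theorem6p16 : ∀ {o ℓ e b : Level} {C : FPCategory o ℓ e}
    (P P∀∃ : BooleanDoctrine C b)
    (𝔦 : NaturalTransformation (BooleanDoctrine.functor P)
    (BooleanDoctrine.functor P∀∃ ∘F Functor.opF idF)) →
    IsQuantifierCompletion {P = P} {Q = P∀∃} ⟪ idFP , 𝔦 ⟫ →
    (P-elementary : IsElementary P) →
    Σ (IsElementary P∀∃) λ P∀∃-elementary →
    IsElementaryMorphism P-elementary P∀∃-elementary ⟪ idFP , 𝔦 ⟫
theorem6p16 {C = C} P P∀∃ 𝔦 completion P-elementary =
  record
    { δ              = δ′
    ; δ-reflexive    = δ-reflexive
    -- Induction with `Substitutive` as `S`: all remaining laws of `δ′` come by transport, but this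
    -- one speaks of predicates outside the image of `𝔦`.
    ; δ-substitutive = λ X α → completion-induction completion
        substitutive-isSubdoctrine
        (substitutive-all (IsQuantifierCompletion.isFirstOrder completion))
        (λ Y β → transport-substitutive {C = C} {P} {P∀∃} 𝔦 {P.δ} (P.δ-substitutive Y β))
        α
    ; δ-product      = δ-product
    -- `δ′` is the image of the equality of `P` by definition, so only reindexing along the
    -- comparison map `⟨ π₁ , π₂ ⟩` has to be removed.
    } , λ X → π₁≐π₂
  where
  open FPCategory C using (_⊗_)
  module P = IsElementary P-elementary
  module ⟪𝔦⟫ = DoctrineMorphism {P = P} {R = P∀∃} ⟪ idFP , 𝔦 ⟫

  δ′ : RelationFamily P∀∃
  δ′ X = ⟪𝔦⟫.component (X ⊗ X) (P.δ X)

  pre : IsPreEquality P∀∃ δ′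
  pre = transport-preEquality {C = C} {P} {P∀∃} 𝔦 (elementary⇒preEquality P-elementary)

  open IsPreEquality pre
  open Equality P∀∃ δ′
  open PreEquality pre
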